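{- Suppose that the logic $\vdash$ has (1) the Maehara interpolation property, (2) right uniform deductive interpolation, and (3) left-finitary uniform deductive interpolation (with the finite sets $\Theta_1,\dots,\Theta_n$ effectively computable from $\Delta$). If both $\vdash$ itself and the $\vdash$-admissibility problem for standard rules are decidable, then the $\vdash$-admissibility problem for $\Pi_2$-rules is decidable.
   Context: Let $\mathcal{L}$ be a functional signature containing at least one constant symbol, and $Fm_{\mathcal{L}}$ the set of $\mathcal{L}$-formulas over a countably infinite set of propositional variables. $\vdash\subseteq\wp(Fm_{\mathcal{L}})\times Fm_{\mathcal{L}}$ is a logic (identity, monotonicity, transitivity, structurality, finitarity) which is strongly algebraizable: algebraizable (Blok–Pigozzi) with equivalent algebraic semantics a variety $\mathbf{K}$. $\Gamma\vdash\Delta$ means $\Gamma\vdash\psi$ for all $\psi\in\Delta$. Tuples $\overline p,\overline q,\overline r$ consist of distinct variables and are pairwise disjoint; $\phi(\overline p,\overline q)$ means the variables of $\phi$ are among $\overline p,\overline q$. Maehara interpolation: for all finite $\overline p,\overline q,\overline r$ and finite sets $\Sigma(\overline p,\overline q),\Delta(\overline q,\overline r),\Sigma'(\overline p,\overline q)$, if $\Sigma\cup\Delta\vdash\Sigma'$ then there is a set $\Pi(\overline q)$ with $\Delta\vdash\Pi$ and $\Sigma\cup\Pi\vdash\Sigma'$. Right uniform deductive interpolation: for all finite $\overline p,\overline q$ and finite $\Sigma(\overline p,\overline q)$ there is a finite $\Pi(\overline q)$ such that for all finite $\overline r$ and finite $\Delta(\overline q,\overline r)$: $\Sigma\vdash\Delta$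 iff $\Pi\vdash\Delta$. Left-finitary uniform deductive interpolation: for all finite $\overline q,\overline r$ and finite $\Delta(\overline q,\overline r)$ there are finitely many finite sets $\Theta_1(\overline q),\dots,\Theta_n(\overline q)$ such that (i) $\Theta_i\vdash\Delta$ for each $i$, and (ii) for all $\overline p$ and $\Sigma(\overline p,\overline q)$, if $\Sigma\vdash\Delta$ then $\Sigma\vdash\Theta_i$ for some $i$. A $\Pi_2$-rule $\forall\overline{p}\,\Gamma/^2\psi$ is given by a finite set $\Gamma$ of formulas in variables $\overline p,\overline q$ and a formula $\psi(\overline q)$; it is standard if $\overline p$ is empty. Fix a Hilbert-style system $\vdash_S$ for $\vdash$. For a set $\Sigma$ of $\Pi_2$-rules, $\vdash_{S\oplus\Sigma}\chi$ means there is a sequence ending in $\chi$ in which each member is an axiom instance of $S$, or follows from earlier members by a rule of $S$, or is $\chi'(\overline\xi/\overline q)$ for a rule $\forall\overline p\,\{\mu_j(\overline p,\overline q)\}_j/^2\chi'(\overline q)\in\Sigma$ all of whose premises $\mu_j(\overline r/\overline p,\overline\xi/\overline q)$ occur earlier, with $\overline r$ fresh variables not occurring in $\overline\xi$. A rule $R$ is admissible over $\vdash$ if $\vdash_{S\oplus R}\chi$ implies $\vdash_S\chi$ for all $\chi$. The $\vdash$-admissibility problem for $\Pi_2$-rules asks, given a finite set $\Gamma$, a formula $\phi$ and a set $C=\overline p$ of variables occurring in $\Gamma$ but not in $\phi$, whether $\forall\overline p\,\Gamma/^2\phi$ is admissible over $\vdash$; the admissibility problem for standard rules is the case $C=\emptyset$.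 -}

module Defs where

open import Level using (0ℓ)
open import Data.Nat using (ℕ; zero; suc)
open import Data.Fin using (Fin)
open import Data.List using (List; []; _∷_; _++_)
open import Data.List.Membership.Propositional using (_∈_; _∉_)
open import Data.List.Relation.Unary.All using (All)
open import Data.List.Relation.Unary.Any using (Any)
open import Data.List.Relation.Unary.Unique.Propositional using (Unique)
open import Data.List.Relation.Binary.Disjoint.Propositional using (Disjoint)
open import Data.Product using (Σ; ∃; _×_; _,_; proj₁; proj₂)
open import Data.Sum using (_⊎_)
open import Relation.Nullary using (¬_; Dec)
open import Relation.Unary using (Pred; _∪_; _⊆_; ∅)
open import Relation.Binary.PropositionalEquality using (_≡_)
open import Relation.Binary.Structures using (IsEquivalence)
open import Function.Bundles using (_⇔_)

record Signature : Set₁ where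
  field
    Op           : Set
    arity        : Op → ℕ
    someConstant : Σ Op (λ c → arity c ≡ 0)

module Syntax (𝓛 : Signature) where
  open Signature 𝓛

  data Fm : Set where
    var : ℕ → Fm
    op  : (o : Op) → (Fin (arity o) → Fm) → Fm

  data Occurs (x : ℕ) : Fm → Set where
    here  : Occurs x (var x)
    under : ∀ {o ts} (i : Fin (arity o)) → Occurs x (ts i) → Occurs x (op o ts)

  _over_ : Fm → List ℕ → Set
  φ over xs = ∀ x → Occurs x φ → x ∈ xs

  _allOver_ : List Fm → List ℕ → Set
  Γ allOver xs = All (_over xs) Γ

  Subst : Set
  Subst = ℕ → Fm

  sub : Subst → Fm → Fm
  sub σ (var x)   = σ x
  sub σ (op o ts) = op o (λ i → sub σ (ts i))

  FmSet : Set₁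
  FmSet = Pred Fm 0ℓ

  ⟦_⟧ : List Fm → FmSet
  ⟦ Γ ⟧ φ = φ ∈ Γ

  subSet : Subst → FmSet → FmSet
  subSet σ Γ ψ = ∃ λ φ → Γ φ × ψ ≡ sub σ φ

  Cons : Set₁
  Cons = FmSet → Fm → Set

  _⊢*[_]_ : FmSet → Cons → FmSet → Set
  Γ ⊢*[ _⊢_ ] Δ = ∀ ψ → Δ ψ → Γ ⊢ ψ

  record IsLogic (_⊢_ : Cons) : Set₁ where
    field
      identity     : ∀ {Γ φ} → Γ φ → Γ ⊢ φ
      monotonicity : ∀ {Γ Γ' φ} → Γ ⊆ Γ' → Γ ⊢ φ → Γ' ⊢ φ
      transitivity : ∀ {Γ Δ φ} → Γ ⊢*[ _⊢_ ] Δ → Δ ⊢ φ → Γ ⊢ φ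
      structurality : ∀ {Γ φ} (σ : Subst) → Γ ⊢ φ → subSet σ Γ ⊢ sub σ φ
      finitarity   : ∀ {Γ φ} → Γ ⊢ φ → ∃ λ (Γ₀ : List Fm) → All Γ Γ₀ × ⟦ Γ₀ ⟧ ⊢ φ

  record Algebra : Set₁ where
    field
      Carrier : Set
      _≈_     : Carrier → Carrier → Set
      isEquivalence : IsEquivalence _≈_
      ⟦_⟧op   : (o : Op) → (Fin (arity o) → Carrier) → Carrier
      op-cong : ∀ o {xs ys} → (∀ i → xs i ≈ ys i) → ⟦ o ⟧op xs ≈ ⟦ o ⟧op ys

  eval : (A : Algebra) → (ℕ → Algebra.Carrier A) → Fm → Algebra.Carrier A
  eval A v (var x)   = v x
  eval A v (op o ts) = Algebra.⟦_⟧op A o (λ i → eval A v (ts i))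

  Equation : Set
  Equation = Fm × Fm

  Holds : (A : Algebra) → (ℕ → Algebra.Carrier A) → Equation → Set
  Holds A v (s , t) = Algebra._≈_ A (eval A v s) (eval A v t)

  ModelOf : Pred Equation 0ℓ → Algebra → Set
  ModelOf E A = ∀ e → E e → ∀ v → Holds A v e

  _⊨[_]_ : Pred Equation 0ℓ → Pred Equation 0ℓ → Equation → Set₁
  Θ ⊨[ E ] e = ∀ A → ModelOf E A → ∀ v → (∀ e' → Θ e' → Holds A v e') → Holds A v e

  _⊨*[_]_ : Pred Equation 0ℓ → Pred Equation 0ℓ → Pred Equation 0ℓ → Set₁
  Θ ⊨*[ E ] Θ' = ∀ e → Θ' e → Θ ⊨[ E ] e

  at0 : Fm → Subst
  at0 φ zero    = φ
  at0 φ (suc n) = var (suc n)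

  at01 : Fm → Fm → Subst
  at01 ε δ zero          = ε
  at01 ε δ (suc zero)    = δ
  at01 ε δ (suc (suc n)) = var (suc (suc n))

  subEq : Subst → Equation → Equation
  subEq σ (s , t) = sub σ s , sub σ t

  -- τ[Γ] for a set Γ, given τ(x) as a finite list of equations in x = var 0
  τ[_]_ : List Equation → FmSet → Pred Equation 0ℓ
  (τ[ τ ] Γ) e = ∃ λ φ → Γ φ × Any (λ e' → e ≡ subEq (at0 φ) e') τ

  ⟦_⟧eq : List Equation → Pred Equation 0ℓ
  ⟦ Θ ⟧eq e = e ∈ Θ

  -- Blok–Pigozzi algebraizability whose equivalent algebraic
  -- semantics is a variety K = Mod(E).
  record StronglyAlgebraizable (_⊢_ : Cons) : Set₂ where
    field
      E     : Pred Equation 0ℓ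
      τ     : List Equation
      τ-var : All (λ e → (proj₁ e over (0 ∷ [])) × (proj₂ e over (0 ∷ []))) τ
      Δ     : List Fm
      Δ-var : Δ allOver (0 ∷ 1 ∷ [])
      alg1  : ∀ (Γ : FmSet) (φ : Fm) →
              (Γ ⊢ φ) ⇔ ((τ[ τ ] Γ) ⊨*[ E ] (τ[ τ ] (λ ψ → ψ ≡ φ)))
      alg4₁ : ∀ ε δ → (λ e → e ≡ (ε , δ)) ⊨*[ E ] (τ[ τ ] (λ ψ → Any (λ θ → ψ ≡ sub (at01 ε δ) θ) Δ))
      alg4₂ : ∀ ε δ → (τ[ τ ] (λ ψ → Any (λ θ → ψ ≡ sub (at01 ε δ) θ) Δ)) ⊨*[ E ] (λ e → e ≡ (ε , δ))

  -- a rule of a Hilbert system: finite premises and a conclusion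
  -- (axioms are the rules with no premises); instances by substitution
  HilbertSystem : Set₁
  HilbertSystem = Pred (List Fm × Fm) 0ℓ

  record Π2Rule : Set where
    constructor ∀[_]_/²_
    field
      bound      : List ℕ
      premises   : List Fm
      conclusion : Fm
  open Π2Rule public

  OccursInRule : ℕ → Π2Rule → Set
  OccursInRule y R = Occurs y (conclusion R) ⊎ Any (Occurs y) (premises R)

  module Derivations (S : HilbertSystem) (Rs : List Π2Rule) (Hyp : FmSet) where

    data Justified (prev : List Fm) (φ : Fm) : Set where
      hyp  : Hyp φ → Justified prev φ
      byS  : ∀ {Γr ψ} → S (Γr , ψ) → (σ : Subst) → φ ≡ sub σ ψ
           → All (λ γ → sub σ γ ∈ prev) Γr → Justified prev φ
      byΠ2 : ∀ {R} → R ∈ Rs → (σ : Subst) → (ρ : ℕ → ℕ)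
           → (∀ x → x ∈ bound R → σ x ≡ var (ρ x))
           → (∀ x x' → x ∈ bound R → x' ∈ bound R → ρ x ≡ ρ x' → x ≡ x')
           → (∀ x y → x ∈ bound R → OccursInRule y R → y ∉ bound R → ¬ Occurs (ρ x) (σ y))
           → φ ≡ sub σ (conclusion R)
           → All (λ μ → sub σ μ ∈ prev) (premises R)
           → Justified prev φ

    -- derivation sequences, stored with the latest member first
    data Seq : List Fm → Set where
      []  : Seq []
      _∷_ : ∀ {φ prev} → Justified prev φ → Seq prev → Seq (φ ∷ prev)

    Derivable : Fm → Set
    Derivable φ = ∃ λ prev → Seq (φ ∷ prev)

  _⊢⟨_⊕_⟩_ : FmSet → HilbertSystem → List Π2Rule → Fm → Set
  Γ ⊢⟨ S ⊕ Rs ⟩ φ = Derivations.Derivable S Rs Γ φ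

  Presents : HilbertSystem → Cons → Set₁
  Presents S _⊢_ = ∀ Γ φ → (Γ ⊢ φ) ⇔ (Γ ⊢⟨ S ⊕ [] ⟩ φ)

  Admissible : HilbertSystem → Π2Rule → Set
  Admissible S R = ∀ χ → ∅ ⊢⟨ S ⊕ (R ∷ []) ⟩ χ → ∅ ⊢⟨ S ⊕ [] ⟩ χ

  MaeharaInterpolation : Cons → Set₁
  MaeharaInterpolation _⊢_ =
    ∀ (p q r : List ℕ) → Unique p → Unique q → Unique r
    → Disjoint p q → Disjoint q r → Disjoint p r
    → ∀ (Sg D Sg' : List Fm)
    → Sg allOver (p ++ q) → D allOver (q ++ r) → Sg' allOver (p ++ q)
    → (⟦ Sg ⟧ ∪ ⟦ D ⟧) ⊢*[ _⊢_ ] ⟦ Sg' ⟧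
    → ∃ λ (Π : FmSet) → (∀ π → Π π → π over q)
        × (⟦ D ⟧ ⊢*[ _⊢_ ] Π) × ((⟦ Sg ⟧ ∪ Π) ⊢*[ _⊢_ ] ⟦ Sg' ⟧)

  RightUniformDeductiveInterpolation : Cons → Set
  RightUniformDeductiveInterpolation _⊢_ =
    ∀ (p q : List ℕ) → Unique p → Unique q → Disjoint p q
    → ∀ (Sg : List Fm) → Sg allOver (p ++ q)
    → ∃ λ (Π : List Fm) → Π allOver q
        × (∀ (r : List ℕ) → Unique r → Disjoint p r → Disjoint q r
           → ∀ (D : List Fm) → D allOver (q ++ r)
           → (⟦ Sg ⟧ ⊢*[ _⊢_ ] ⟦ D ⟧) ⇔ (⟦ Π ⟧ ⊢*[ _⊢_ ] ⟦ D ⟧))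

  -- left-finitary uniform deductive interpolation, with the sets
  -- Θ₁,…,Θₙ given by a (computable) function θ of Δ
  record EffectiveLeftFinitaryUDI (_⊢_ : Cons) : Set where
    field
      θ : (q r : List ℕ) → Unique q → Unique r → Disjoint q r
        → (D : List Fm) → D allOver (q ++ r) → List (List Fm)
      θ-sound : ∀ (q r : List ℕ) (uq : Unique q) (ur : Unique r) (dqr : Disjoint q r)
          (D : List Fm) (hD : D allOver (q ++ r))
        → All (λ Θ → (Θ allOver q) × (⟦ Θ ⟧ ⊢*[ _⊢_ ] ⟦ D ⟧)) (θ q r uq ur dqr D hD)
      θ-complete : ∀ (q r : List ℕ) (uq : Unique q) (ur : Unique r) (dqr : Disjoint q r)
          (D : List Fm) (hD : D allOver (q ++ r))
        → ∀ (p : List ℕ) → Unique p → Disjoint p q → Disjoint p r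
        → ∀ (Sg : List Fm) → Sg allOver (p ++ q)
        → ⟦ Sg ⟧ ⊢*[ _⊢_ ] ⟦ D ⟧
        → Any (λ Θ → ⟦ Sg ⟧ ⊢*[ _⊢_ ] ⟦ Θ ⟧) (θ q r uq ur dqr D hD)

  -- Decision problems (decidable = decided by an Agda function)

  DecidableLogic : Cons → Set
  DecidableLogic _⊢_ = ∀ (Γ : List Fm) (φ : Fm) → Dec (⟦ Γ ⟧ ⊢ φ)

  StandardAdmissibilityDecidable : HilbertSystem → Set
  StandardAdmissibilityDecidable S =
    ∀ (Γ : List Fm) (φ : Fm) → Dec (Admissible S (∀[ [] ] Γ /² φ))

  Π2AdmissibilityDecidable : HilbertSystem → Set
  Π2AdmissibilityDecidable S =
    ∀ (C : List ℕ) (Γ : List Fm) (φ : Fm)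
    → All (λ x → Any (Occurs x) Γ) C
    → All (λ x → ¬ Occurs x φ) C
    → Dec (Admissible S (∀[ C ] Γ /² φ))

-- Let q be the variables of Γ outside C and Θ₁, …, Θₙ the left uniform interpolants of Γ
-- over q. Then ∀C Γ /² φ is admissible iff every standard rule Θᵢ / φ is, so one decides
-- it by finitely many standard admissibility queries.
-- (⇒) Given theorems σΘᵢ, rename the bound variables C apart from σ; as Θᵢ ⊢ Γ and the
-- renaming does not touch q, the renamed instance of Γ consists of theorems, and the
-- Π₂-rule yields σφ.
-- (⇐) Given an instance σ of the Π₂-rule with σΓ theorems, let σ̃ be σ followed by the
-- renaming that sends the fresh variables ρ(C) back to C and shifts all other variables
-- above those of Γ. The equations Σ = {Δ(y, σ̃ y) : y ∈ q} entail Γ, hence some Θᵢ by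
-- left uniform interpolation; undoing the shift while applying σ to q sends Σ to
-- theorems, so σΘᵢ are theorems and the standard rule yields σφ.
-- All entailments between substitution instances are checked in the equivalent
-- algebraic semantics.

module Submission where

open import Defs
open import Data.Nat using (ℕ; suc; _+_; _∸_; _≤_; _<_; _≟_; _≤?_; s≤s)
open import Data.Nat.Properties using (≤-refl; +-cancelʳ-≡; m+n≮n; <⇒≱; m≤n+m; m+n∸n≡m)
import Data.Fin.Properties as Fin
open import Data.List using (List; []; _∷_; _++_; map; filter; upTo; tabulate; concatMap)
open import Data.List.Extrema.Nat using (max; v≤max⁺)
open import Data.List.Membership.Propositional using (_∈_; _∉_; find; lose)
open import Data.List.Membership.Propositional.Properties
  using ( ∈-filter⁺; ∈-filter⁻; ∈-upTo⁺; ∈-upTo⁻; ∈-++⁺ˡ; ∈-++⁺ʳ; ∈-map⁺; ∈-map⁻; ∈-tabulate⁺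
        ; ∈-concatMap⁺; ∈-concatMap⁻)
open import Data.List.Membership.DecPropositional _≟_ using (_∈?_)
open import Data.List.Relation.Unary.All as All using (All; []; _∷_)
open import Data.List.Relation.Unary.Any as Any using (Any; here; there; any?)
import Data.List.Relation.Unary.Any.Properties as Anyₚ
import Data.List.Relation.Unary.All.Properties as Allₚ
open import Data.List.Relation.Unary.Unique.Propositional using (Unique)
import Data.List.Relation.Unary.Unique.Propositional.Properties as Unique
open import Data.List.Relation.Binary.Disjoint.Propositional using (Disjoint)
open import Data.Product using (∃; _×_; _,_; proj₁; proj₂)
open import Data.Sum using (inj₁; inj₂)
open import Data.Empty using (⊥-elim)
open import Function using (_∘_; id; case_of_)
open import Relation.Nullary using (¬_; Dec; yes; no; ¬?)
open import Relation.Nullary.Decidable using (map′)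
import Relation.Nullary.Decidable as Dec
open import Relation.Unary using (∅)
open import Relation.Binary.PropositionalEquality using (_≡_; refl; sym; trans; cong; subst)
open import Relation.Binary.Structures using (IsEquivalence)
open import Function.Bundles using (_⇔_; mk⇔; Equivalence)

module Variables (𝓛 : Signature) where
  open Syntax 𝓛

  maxVar : Fm → ℕ
  maxVar (var x)   = x
  maxVar (op o ts) = max 0 (tabulate (λ i → maxVar (ts i)))

  occurs⇒≤maxVar : ∀ {x} φ → Occurs x φ → x ≤ maxVar φ
  occurs⇒≤maxVar (var x)   here         = ≤-refl
  occurs⇒≤maxVar (op o ts) (under i oc) =
    v≤max⁺ 0 _ (inj₂ (lose (∈-tabulate⁺ i) (occurs⇒≤maxVar (ts i) oc)))

  varBound : List Fm → ℕ
  varBound Γ = suc (max 0 (map maxVar Γ))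

  occurs⇒<varBound : ∀ {x γ Γ} → γ ∈ Γ → Occurs x γ → x < varBound Γ
  occurs⇒<varBound {γ = γ} γ∈Γ oc =
    s≤s (v≤max⁺ 0 _ (inj₂ (lose (∈-map⁺ maxVar γ∈Γ) (occurs⇒≤maxVar γ oc))))

  occurs? : ∀ x φ → Dec (Occurs x φ)
  occurs? x (var y) with x ≟ y
  ... | yes refl = yes here
  ... | no x≢y   = no λ { here → x≢y refl }
  occurs? x (op o ts) =
    map′ (λ (i , oc) → under i oc) (λ { (under i oc) → i , oc })
         (Fin.any? (λ i → occurs? x (ts i)))

  occurs-var⁻ : ∀ {x y} → Occurs x (var y) → x ≡ y
  occurs-var⁻ here = refl

  occurs-sub⁻ : ∀ {x} σ φ → Occurs x (sub σ φ) → ∃ λ z → Occurs z φ × Occurs x (σ z)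
  occurs-sub⁻ σ (var z)   oc           = z , here , oc
  occurs-sub⁻ σ (op o ts) (under i oc) =
    let z , z∈ts , x∈σz = occurs-sub⁻ σ (ts i) oc in z , under i z∈ts , x∈σz

  occursIn? : ∀ Γ x → Dec (Any (Occurs x) Γ)
  occursIn? Γ x = any? (occurs? x) Γ

  occurs-image⇒<varBound : ∀ {x y m} (σ : Subst) → y < m → Occurs x (σ y)
                         → x < varBound (map σ (upTo m))
  occurs-image⇒<varBound σ y<m = occurs⇒<varBound (∈-map⁺ σ (∈-upTo⁺ y<m))

  vars : List Fm → List ℕ
  vars Γ = filter (occursIn? Γ) (upTo (varBound Γ))

  vars-unique : ∀ Γ → Unique (vars Γ)
  vars-unique Γ = Unique.filter⁺ (occursIn? Γ) (Unique.upTo⁺ (varBound Γ))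

  ∈-vars⁺ : ∀ {x} Γ → Any (Occurs x) Γ → x ∈ vars Γ
  ∈-vars⁺ Γ x∈Γ = let _ , γ∈Γ , oc = find x∈Γ in
    ∈-filter⁺ (occursIn? Γ) (∈-upTo⁺ (occurs⇒<varBound γ∈Γ oc)) x∈Γ

  ∈-vars⁻ : ∀ {x} Γ → x ∈ vars Γ → Any (Occurs x) Γ × x < varBound Γ
  ∈-vars⁻ Γ x∈ = let x∈upTo , x∈Γ = ∈-filter⁻ (occursIn? Γ) {xs = upTo (varBound Γ)} x∈ in
    x∈Γ , ∈-upTo⁻ x∈upTo

module Evaluation (𝓛 : Signature) (A : Syntax.Algebra 𝓛) where
  open Syntax 𝓛
  open Algebra A
  open IsEquivalence isEquivalence renaming (refl to ≈-refl; sym to ≈-sym; trans to ≈-trans)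

  eval-sub : ∀ (σ : Subst) φ v → eval A v (sub σ φ) ≈ eval A (eval A v ∘ σ) φ
  eval-sub σ (var x)   v = ≈-refl
  eval-sub σ (op o ts) v = op-cong o (λ i → eval-sub σ (ts i) v)

  eval-cong : ∀ φ {v w} → (∀ x → Occurs x φ → v x ≈ w x) → eval A v φ ≈ eval A w φ
  eval-cong (var x)   v≈w = v≈w x here
  eval-cong (op o ts) v≈w = op-cong o (λ i → eval-cong (ts i) (λ x oc → v≈w x (under i oc)))

  eval-sub-cong : ∀ (σ : Subst) φ {v w} → (∀ x → Occurs x φ → eval A v (σ x) ≈ w x)
                → eval A v (sub σ φ) ≈ eval A w φ
  eval-sub-cong σ φ {v} σ≈w = ≈-trans (eval-sub σ φ v) (eval-cong φ σ≈w)

module Algebraizable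
  (𝓛 : Signature) (_⊢_ : Syntax.Cons 𝓛) (SA : Syntax.StronglyAlgebraizable 𝓛 _⊢_) where
  open Syntax 𝓛
  open Variables 𝓛
  open StronglyAlgebraizable SA

  module _ (A : Algebra) where
    open Algebra A
    open IsEquivalence isEquivalence using () renaming (refl to ≈-refl; sym to ≈-sym; trans to ≈-trans)
    open Evaluation 𝓛 A

    Designated : Carrier → Set
    Designated a = All (Holds A (λ _ → a)) τ

    designated-resp : ∀ {a b} → a ≈ b → Designated a → Designated b
    designated-resp {a} {b} a≈b = All.map (λ {e} → resp e)
      where
        resp : ∀ e → Holds A (λ _ → a) e → Holds A (λ _ → b) e
        resp (s , t) s≈t =
          ≈-trans (eval-cong s (λ _ _ → ≈-sym a≈b)) (≈-trans s≈t (eval-cong t (λ _ _ → a≈b)))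

    SatisfiesTranslation : (ℕ → Carrier) → Fm → Set
    SatisfiesTranslation v γ = ∀ e → Any (λ e' → e ≡ subEq (at0 γ) e') τ → Holds A v e

    designated⇔satisfiesTranslation : ∀ v γ → Designated (eval A v γ) ⇔ SatisfiesTranslation v γ
    designated⇔satisfiesTranslation v γ = mk⇔ to from
      where
        at0-eval : ∀ s → s over (0 ∷ []) → eval A v (sub (at0 γ) s) ≈ eval A (λ _ → eval A v γ) s
        at0-eval s s-over = eval-sub-cong (at0 γ) s λ x oc → at0-var (s-over x oc)
          where
            at0-var : ∀ {x} → x ∈ 0 ∷ [] → eval A v (at0 γ x) ≈ eval A v γ
            at0-var (here refl) = ≈-refl

        to : Designated (eval A v γ) → SatisfiesTranslation v γ
        to dγ e e∈τγ with find e∈τγ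
        ... | (s , t) , e'∈τ , refl = let s-over , t-over = All.lookup τ-var e'∈τ in
          ≈-trans (at0-eval s s-over) (≈-trans (All.lookup dγ e'∈τ) (≈-sym (at0-eval t t-over)))

        from : SatisfiesTranslation v γ → Designated (eval A v γ)
        from hγ = All.tabulate λ {(s , t)} e∈τ → let s-over , t-over = All.lookup τ-var e∈τ in
          ≈-trans (≈-sym (at0-eval s s-over))
                  (≈-trans (hγ _ (Any.map (cong (subEq (at0 γ))) e∈τ)) (at0-eval t t-over))

  _⊨_ : FmSet → Fm → Set₁
  Γ ⊨ φ = ∀ A → ModelOf E A → ∀ v
        → (∀ γ → Γ γ → Designated A (eval A v γ)) → Designated A (eval A v φ)

  ⊢⇒⊨ : ∀ {Γ φ} → Γ ⊢ φ → Γ ⊨ φ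
  ⊢⇒⊨ {Γ} {φ} Γ⊢φ A A⊨E v vΓ = Equivalence.from (designated⇔satisfiesTranslation A v φ)
    λ e e∈τφ → Equivalence.to (alg1 Γ φ) Γ⊢φ e (φ , refl , e∈τφ) A A⊨E v
      λ { e' (γ , γ∈Γ , e'∈τγ) →
            Equivalence.to (designated⇔satisfiesTranslation A v γ) (vΓ γ γ∈Γ) e' e'∈τγ }

  ⊨⇒⊢ : ∀ {Γ φ} → Γ ⊨ φ → Γ ⊢ φ
  ⊨⇒⊢ {Γ} {φ} Γ⊨φ = Equivalence.from (alg1 Γ φ) λ { e (_ , refl , e∈τφ) A A⊨E v vτΓ →
    Equivalence.to (designated⇔satisfiesTranslation A v φ)
      (Γ⊨φ A A⊨E v λ γ γ∈Γ → Equivalence.from (designated⇔satisfiesTranslation A v γ)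
        λ e' e'∈τγ → vτΓ e' (γ , γ∈Γ , e'∈τγ))
      e e∈τφ }

  Δ⟨_,_⟩ : Fm → Fm → List Fm
  Δ⟨ ε , δ ⟩ = map (sub (at01 ε δ)) Δ

  module _ (A : Algebra) (A⊨E : ModelOf E A) (v : ℕ → Algebra.Carrier A) where
    open Algebra A

    Δ-designated⇒≈ : ∀ ε δ → All (Designated A ∘ eval A v) Δ⟨ ε , δ ⟩
                   → eval A v ε ≈ eval A v δ
    Δ-designated⇒≈ ε δ vΔ = alg4₂ ε δ (ε , δ) refl A A⊨E v λ { e (ψ , ψ∈Δ , e∈τψ) →
      Equivalence.to (designated⇔satisfiesTranslation A v ψ) (All.lookup vΔ (Anyₚ.map⁺ ψ∈Δ)) e e∈τψ }

    ≈⇒Δ-designated : ∀ ε δ → eval A v ε ≈ eval A v δ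
                   → All (Designated A ∘ eval A v) Δ⟨ ε , δ ⟩
    ≈⇒Δ-designated ε δ ε≈δ = All.tabulate λ {ψ} ψ∈Δ →
      Equivalence.from (designated⇔satisfiesTranslation A v ψ) λ e e∈τψ →
        alg4₁ ε δ e (ψ , Anyₚ.map⁻ ψ∈Δ , e∈τψ) A A⊨E v λ { _ refl → ε≈δ }

  Δ-over : ∀ {ε δ xs} → ε over xs → δ over xs → Δ⟨ ε , δ ⟩ allOver xs
  Δ-over {ε} {δ} {xs} ε-over δ-over =
    All.tabulate λ ψ∈Δ x x∈ψ → over (∈-map⁻ (sub (at01 ε δ)) ψ∈Δ) x∈ψ
    where
      over : ∀ {ψ x} → ∃ (λ θ₀ → θ₀ ∈ Δ × ψ ≡ sub (at01 ε δ) θ₀) → Occurs x ψ → x ∈ xs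
      over (θ₀ , θ₀∈Δ , refl) x∈ψ with occurs-sub⁻ (at01 ε δ) θ₀ x∈ψ
      ... | z , z∈θ₀ , x∈z with All.lookup Δ-var θ₀∈Δ z z∈θ₀
      ...   | here refl         = ε-over _ x∈z
      ...   | there (here refl) = δ-over _ x∈z

  -- Without function extensionality the two instances need not be equal, so the
  -- agreement is transported through the algebraic semantics instead.
  ⊢-sub-cong : ∀ {σ₁ σ₂ : Subst} φ → (∀ x → Occurs x φ → σ₁ x ≡ σ₂ x)
             → ∅ ⊢ sub σ₁ φ → ∅ ⊢ sub σ₂ φ
  ⊢-sub-cong {σ₁} {σ₂} φ σ₁≡σ₂ ⊢σ₁φ = ⊨⇒⊢ λ A A⊨E v _ →
    designated-resp A (σ₁φ≈σ₂φ A v) (⊢⇒⊨ ⊢σ₁φ A A⊨E v λ _ ())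
    where
      σ₁φ≈σ₂φ : ∀ A v → Algebra._≈_ A (eval A v (sub σ₁ φ)) (eval A v (sub σ₂ φ))
      σ₁φ≈σ₂φ A v =
        ≈-trans (eval-sub-cong σ₁ φ λ x x∈φ → reflexive (cong (eval A v) (σ₁≡σ₂ x x∈φ)))
                (≈-sym (eval-sub σ₂ φ v))
        where
          open Algebra A
          open IsEquivalence isEquivalence using (reflexive) renaming (sym to ≈-sym; trans to ≈-trans)
          open Evaluation 𝓛 A

  graphΔ : List ℕ → (ℕ → Fm) → List Fm
  graphΔ ys f = concatMap (λ y → Δ⟨ var y , f y ⟩) ys

  graphΔ-over : ∀ {ys zs} (f : ℕ → Fm) → (∀ {y} → y ∈ ys → f y over zs)
              → graphΔ ys f allOver (zs ++ ys)
  graphΔ-over {ys} {zs} f f-over = All.tabulate λ ψ∈graph →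
    let y , y∈ys , ψ∈Δ = find (∈-concatMap⁻ (λ y → Δ⟨ var y , f y ⟩) {xs = ys} ψ∈graph) in
    All.lookup (Δ-over (λ { _ here → ∈-++⁺ʳ zs y∈ys }) (λ x x∈fy → ∈-++⁺ˡ (f-over y∈ys x x∈fy)))
               ψ∈Δ

  module _ (A : Algebra) (A⊨E : ModelOf E A) (v : ℕ → Algebra.Carrier A) where
    open Algebra A

    graphΔ-designated⇒≈ : ∀ {ys} f → (∀ ψ → ψ ∈ graphΔ ys f → Designated A (eval A v ψ))
                        → ∀ {y} → y ∈ ys → v y ≈ eval A v (f y)
    graphΔ-designated⇒≈ f vgraph y∈ys = Δ-designated⇒≈ A A⊨E v (var _) (f _)
      (All.tabulate λ ψ∈Δ → vgraph _ (∈-concatMap⁺ (λ y → Δ⟨ var y , f y ⟩) (lose y∈ys ψ∈Δ)))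

    ≈⇒graphΔ-designated : ∀ {ys} f → (∀ {y} → y ∈ ys → v y ≈ eval A v (f y))
                        → ∀ ψ → ψ ∈ graphΔ ys f → Designated A (eval A v ψ)
    ≈⇒graphΔ-designated {ys} f v≈f ψ ψ∈graph =
      let y , y∈ys , ψ∈Δ = find (∈-concatMap⁻ (λ y → Δ⟨ var y , f y ⟩) {xs = ys} ψ∈graph) in
      All.lookup (≈⇒Δ-designated A A⊨E v (var y) (f y) (v≈f y∈ys)) ψ∈Δ

module Admissibility (𝓛 : Signature) (_⊢_ : Syntax.Cons 𝓛) (L : Syntax.IsLogic 𝓛 _⊢_)
  (S : Syntax.HilbertSystem 𝓛) (S⊢ : Syntax.Presents 𝓛 S _⊢_) where
  open Syntax 𝓛
  open IsLogic L

  Instance : Π2Rule → Subst → (ℕ → ℕ) → Set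
  Instance R σ ρ = (∀ x → x ∈ bound R → σ x ≡ var (ρ x))
                 × (∀ x x' → x ∈ bound R → x' ∈ bound R → ρ x ≡ ρ x' → x ≡ x')
                 × (∀ x y → x ∈ bound R → OccursInRule y R → y ∉ bound R → ¬ Occurs (ρ x) (σ y))

  standard-instance : ∀ Θ φ σ → Instance (∀[ [] ] Θ /² φ) σ id
  standard-instance Θ φ σ = (λ _ ()) , (λ _ _ ()) , (λ _ _ ())

  ClosedUnder : Π2Rule → Set
  ClosedUnder R = ∀ σ ρ → Instance R σ ρ
                → All (λ μ → ∅ ⊢ sub σ μ) (premises R) → ∅ ⊢ sub σ (conclusion R)

  Theorems : FmSet
  Theorems ψ = ∅ ⊢ ψ

  module _ (R : Π2Rule) where
    private
      module S⊕R = Derivations S (R ∷ []) ∅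
      module S⊕Theorems = Derivations S [] Theorems
      module S⊕∅ = Derivations S [] ∅

    theoremSeq : ∀ {ψs} → All Theorems ψs → S⊕Theorems.Seq ψs
    theoremSeq []         = S⊕Theorems.[]
    theoremSeq (⊢ψ ∷ ⊢ψs) = S⊕Theorems.hyp ⊢ψ S⊕Theorems.∷ theoremSeq ⊢ψs

    module _ (closed : ClosedUnder R) where
      justified⇒theorem : ∀ {ψs ψ} → S⊕R.Justified ψs ψ → All Theorems ψs → ∅ ⊢ ψ
      justified⇒theorem (S⊕R.hyp ())
      justified⇒theorem {ψs} (S⊕R.byS r σ refl prem) ⊢ψs =
        transitivity (λ _ ⊢ψ → ⊢ψ)
          (Equivalence.from (S⊢ Theorems _)
            (ψs , S⊕Theorems.byS r σ refl prem S⊕Theorems.∷ theoremSeq ⊢ψs))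
      justified⇒theorem (S⊕R.byΠ2 (here refl) σ ρ c₁ c₂ c₃ refl prem) ⊢ψs =
        closed σ ρ (c₁ , c₂ , c₃) (All.map (All.lookup ⊢ψs) prem)

      seq⇒theorems : ∀ {ψs} → S⊕R.Seq ψs → All Theorems ψs
      seq⇒theorems S⊕R.[]      = []
      seq⇒theorems (j S⊕R.∷ s) = let ⊢ψs = seq⇒theorems s in justified⇒theorem j ⊢ψs ∷ ⊢ψs

      closedUnder⇒admissible : Admissible S R
      closedUnder⇒admissible χ (_ , s) = Equivalence.to (S⊢ ∅ χ) (All.head (seq⇒theorems s))

    weaken : ∀ {ψs ψs'} → S⊕∅.Seq ψs → S⊕R.Seq ψs' → S⊕R.Seq (ψs ++ ψs')
    weaken S⊕∅.[] s' = s'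
    weaken (S⊕∅.hyp () S⊕∅.∷ s) s'
    weaken (S⊕∅.byS r σ eq prem S⊕∅.∷ s) s' =
      S⊕R.byS r σ eq (All.map ∈-++⁺ˡ prem) S⊕R.∷ weaken s s'

    concatDerivations : ∀ {ψs} → All S⊕∅.Derivable ψs → ∃ λ ψs' → S⊕R.Seq ψs' × All (_∈ ψs') ψs
    concatDerivations [] = [] , S⊕R.[] , []
    concatDerivations {ψ ∷ _} ((ψs , s) ∷ ds) = let ψs' , s' , ∈ψs' = concatDerivations ds in
      (ψ ∷ ψs) ++ ψs' , weaken s s' , here refl ∷ All.map (∈-++⁺ʳ (ψ ∷ ψs)) ∈ψs'

    admissible⇒closedUnder : Admissible S R → ClosedUnder R
    admissible⇒closedUnder adm σ ρ (c₁ , c₂ , c₃) ⊢σprem =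
      let ψs' , s' , ∈ψs' = concatDerivations (Allₚ.map⁺ (All.map (Equivalence.to (S⊢ ∅ _)) ⊢σprem))
          σprem∈ψs' = Allₚ.map⁻ ∈ψs'
          σconcl = S⊕R.byΠ2 (here refl) σ ρ c₁ c₂ c₃ refl σprem∈ψs'
      in Equivalence.from (S⊢ ∅ _) (adm _ (ψs' , σconcl S⊕R.∷ s'))

module Π2Reduction
  (𝓛 : Signature) (_⊢_ : Syntax.Cons 𝓛) (L : Syntax.IsLogic 𝓛 _⊢_)
  (SA : Syntax.StronglyAlgebraizable 𝓛 _⊢_) (S : Syntax.HilbertSystem 𝓛)
  (S⊢ : Syntax.Presents 𝓛 S _⊢_) (LU : Syntax.EffectiveLeftFinitaryUDI 𝓛 _⊢_)
  (C : List ℕ) (Γ : List (Syntax.Fm 𝓛)) (φ : Syntax.Fm 𝓛)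
  where
  open Syntax 𝓛
  open IsLogic L
  open StronglyAlgebraizable SA using (E)
  open EffectiveLeftFinitaryUDI LU
  open Variables 𝓛
  open Algebraizable 𝓛 _⊢_ SA
  open Admissibility 𝓛 _⊢_ L S S⊢

  R : Π2Rule
  R = ∀[ C ] Γ /² φ

  Standard : List Fm → Π2Rule
  Standard Θ = ∀[ [] ] Θ /² φ

  M : ℕ
  M = varBound Γ

  q r : List ℕ
  q = filter (λ x → ¬? (x ∈? C)) (vars Γ)
  r = filter (_∈? C) (vars Γ)

  q-unique : Unique q
  q-unique = Unique.filter⁺ (λ x → ¬? (x ∈? C)) (vars-unique Γ)

  r-unique : Unique r
  r-unique = Unique.filter⁺ (_∈? C) (vars-unique Γ)

  ∈-q⁺ : ∀ {x γ} → γ ∈ Γ → Occurs x γ → x ∉ C → x ∈ q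
  ∈-q⁺ γ∈Γ x∈γ x∉C = ∈-filter⁺ (λ x → ¬? (x ∈? C)) (∈-vars⁺ Γ (lose γ∈Γ x∈γ)) x∉C

  ∈-q⁻ : ∀ {y} → y ∈ q → y ∈ vars Γ × y ∉ C
  ∈-q⁻ = ∈-filter⁻ (λ x → ¬? (x ∈? C)) {xs = vars Γ}

  ∈-q⇒∉C : ∀ {y} → y ∈ q → y ∉ C
  ∈-q⇒∉C = proj₂ ∘ ∈-q⁻

  ∈-q⇒occurs : ∀ {y} → y ∈ q → Any (Occurs y) Γ
  ∈-q⇒occurs = proj₁ ∘ ∈-vars⁻ Γ ∘ proj₁ ∘ ∈-q⁻

  ∈-q⇒<M : ∀ {y} → y ∈ q → y < M
  ∈-q⇒<M = proj₂ ∘ ∈-vars⁻ Γ ∘ proj₁ ∘ ∈-q⁻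

  ∈-r⁻ : ∀ {y} → y ∈ r → y ∈ C × y < M
  ∈-r⁻ y∈r = let y∈vars , y∈C = ∈-filter⁻ (_∈? C) {xs = vars Γ} y∈r in
    y∈C , proj₂ (∈-vars⁻ Γ y∈vars)

  q⊥r : Disjoint q r
  q⊥r (y∈q , y∈r) = ∈-q⇒∉C y∈q (proj₁ (∈-r⁻ y∈r))

  Γ-over : Γ allOver (q ++ r)
  Γ-over = All.tabulate λ {γ} γ∈Γ x x∈γ → case x ∈? C of λ where
    (yes x∈C) → ∈-++⁺ʳ q (∈-filter⁺ (_∈? C) (∈-vars⁺ Γ (lose γ∈Γ x∈γ)) x∈C)
    (no x∉C)  → ∈-++⁺ˡ (∈-q⁺ γ∈Γ x∈γ x∉C)

  interpolants : List (List Fm)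
  interpolants = θ q r q-unique r-unique q⊥r Γ Γ-over

  interpolant-sound : ∀ {Θ} → Θ ∈ interpolants → (Θ allOver q) × (⟦ Θ ⟧ ⊢*[ _⊢_ ] ⟦ Γ ⟧)
  interpolant-sound = All.lookup (θ-sound q r q-unique r-unique q⊥r Γ Γ-over)

  ruleVar⇒<varBound : ∀ {y} → OccursInRule y R → y < varBound (φ ∷ Γ)
  ruleVar⇒<varBound (inj₁ y∈φ) = occurs⇒<varBound {Γ = φ ∷ Γ} (here refl) y∈φ
  ruleVar⇒<varBound (inj₂ y∈Γ) =
    let _ , γ∈Γ , y∈γ = find y∈Γ in occurs⇒<varBound {Γ = φ ∷ Γ} (there γ∈Γ) y∈γ

  module ShiftBound (σ : Subst) (N : ℕ) where
    shifted : ∀ x → Dec (x ∈ C) → Fm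
    shifted x (yes _) = var (x + N)
    shifted x (no _)  = σ x

    σ' : Subst
    σ' x = shifted x (x ∈? C)

    σ'-∈ : ∀ {x} → x ∈ C → σ' x ≡ var (x + N)
    σ'-∈ {x} x∈C with x ∈? C
    ... | yes _   = refl
    ... | no x∉C = ⊥-elim (x∉C x∈C)

    σ'-∉ : ∀ {x} → x ∉ C → σ' x ≡ σ x
    σ'-∉ {x} x∉C with x ∈? C
    ... | yes x∈C = ⊥-elim (x∉C x∈C)
    ... | no _    = refl

  freshFor : Subst → ℕ
  freshFor σ = varBound (map σ (upTo (varBound (φ ∷ Γ))))

  shiftBound-instance : ∀ σ → Instance R (ShiftBound.σ' σ (freshFor σ)) (_+ freshFor σ)
  shiftBound-instance σ = (λ _ → σ'-∈) , (λ x x' _ _ → +-cancelʳ-≡ N x x') , fresh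
    where
      N : ℕ
      N = freshFor σ
      open ShiftBound σ N

      fresh : ∀ x y → x ∈ C → OccursInRule y R → y ∉ C → ¬ Occurs (x + N) (σ' y)
      fresh x y _ y∈R y∉C x+N∈σ'y = m+n≮n x N
        (occurs-image⇒<varBound σ (ruleVar⇒<varBound y∈R)
          (subst (Occurs (x + N)) (σ'-∉ y∉C) x+N∈σ'y))

  closedUnderΠ2⇒closedUnderInterpolant : All (λ x → ¬ Occurs x φ) C → ClosedUnder R
    → ∀ {Θ} → Θ ∈ interpolants → ClosedUnder (Standard Θ)
  closedUnderΠ2⇒closedUnderInterpolant C∉φ closed {Θ} Θ∈ σ _ _ ⊢σΘ =
    ⊢-sub-cong {σ'} {σ} φ (λ x x∈φ → σ'-∉ (λ x∈C → All.lookup C∉φ x∈C x∈φ))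
      (closed σ' (_+ freshFor σ) (shiftBound-instance σ) ⊢σ'Γ)
    where
      open ShiftBound σ (freshFor σ)

      ⊢σ'θ : ∀ {θ'} → θ' ∈ Θ → ∅ ⊢ sub σ' θ'
      ⊢σ'θ {θ'} θ'∈Θ = ⊢-sub-cong {σ} {σ'} θ'
        (λ x x∈θ' → sym (σ'-∉ (∈-q⇒∉C (All.lookup (proj₁ (interpolant-sound Θ∈)) θ'∈Θ x x∈θ'))))
        (All.lookup ⊢σΘ θ'∈Θ)

      ⊢σ'Γ : All (λ γ → ∅ ⊢ sub σ' γ) Γ
      ⊢σ'Γ = All.tabulate λ γ∈Γ → transitivity (λ { _ (θ' , θ'∈Θ , refl) → ⊢σ'θ θ'∈Θ })
                                                (structurality σ' (proj₂ (interpolant-sound Θ∈) _ γ∈Γ))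

  module InterpolantsToΠ2 (σ : Subst) (ρ : ℕ → ℕ)
    (ρ-var : ∀ x → x ∈ C → σ x ≡ var (ρ x))
    (ρ-injective : ∀ x x' → x ∈ C → x' ∈ C → ρ x ≡ ρ x' → x ≡ x')
    (ρ-fresh : ∀ x y → x ∈ C → OccursInRule y R → y ∉ C → ¬ Occurs (ρ x) (σ y))
    (⊢σΓ : All (λ γ → ∅ ⊢ sub σ γ) Γ)
    where

    -- κ sends each bound variable ρ x back to x and every other variable n to n + M,
    -- beyond the variables of Γ; the remaining variables p of Σ are these shifted ones.
    undoρ : ∀ n → Dec (Any (λ x → ρ x ≡ n) C) → Fm
    undoρ n (yes ρx≡n) = var (proj₁ (find ρx≡n))
    undoρ n (no _)     = var (n + M)

    κ : Subst
    κ n = undoρ n (any? (λ x → ρ x ≟ n) C)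

    κ-ρ : ∀ {x} → x ∈ C → κ (ρ x) ≡ var x
    κ-ρ {x} x∈C with any? (λ x' → ρ x' ≟ ρ x) C
    ... | yes ρx'≡ρx = let _ , x'∈C , ρx'≡ρx = find ρx'≡ρx in
      cong var (ρ-injective _ x x'∈C x∈C ρx'≡ρx)
    ... | no ρx'≢ρx  = ⊥-elim (ρx'≢ρx (lose x∈C refl))

    κ-shift : ∀ {y n} → y ∈ q → Occurs n (σ y) → κ n ≡ var (n + M)
    κ-shift {y} {n} y∈q n∈σy with any? (λ x → ρ x ≟ n) C
    ... | no _       = refl
    ... | yes ρx≡n = let x , x∈C , ρx≡n = find ρx≡n in
      ⊥-elim (ρ-fresh x y x∈C (inj₂ (∈-q⇒occurs y∈q)) (∈-q⇒∉C y∈q)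
        (subst (λ m → Occurs m (σ y)) (sym ρx≡n) n∈σy))

    σ̃ : ℕ → Fm
    σ̃ y = sub κ (σ y)

    K : ℕ
    K = varBound (map σ (upTo M))

    p : List ℕ
    p = map (_+ M) (upTo K)

    p-unique : Unique p
    p-unique = Unique.map⁺ (λ {x} {x'} → +-cancelʳ-≡ M x x') (Unique.upTo⁺ K)

    ∈-p⁻ : ∀ {x} → x ∈ p → M ≤ x
    ∈-p⁻ x∈p with ∈-map⁻ (_+ M) {xs = upTo K} x∈p
    ... | n , _ , refl = m≤n+m M n

    p⊥q : Disjoint p q
    p⊥q (x∈p , x∈q) = <⇒≱ (∈-q⇒<M x∈q) (∈-p⁻ x∈p)

    p⊥r : Disjoint p r
    p⊥r (x∈p , x∈r) = <⇒≱ (proj₂ (∈-r⁻ x∈r)) (∈-p⁻ x∈p)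

    σ̃-over : ∀ {y} → y ∈ q → σ̃ y over p
    σ̃-over {y} y∈q x x∈σ̃y =
      let n , n∈σy , x∈κn = occurs-sub⁻ κ (σ y) x∈σ̃y
          n<K = occurs-image⇒<varBound σ (∈-q⇒<M y∈q) n∈σy
          x≡n+M = occurs-var⁻ (subst (Occurs x) (κ-shift y∈q n∈σy) x∈κn)
      in subst (_∈ p) (sym x≡n+M) (∈-map⁺ (_+ M) (∈-upTo⁺ n<K))

    Σ : List Fm
    Σ = graphΔ q σ̃

    Σ-over : Σ allOver (p ++ q)
    Σ-over = graphΔ-over σ̃ σ̃-over

    unshift : ∀ n → Dec (M ≤ n) → Fm
    unshift n (yes _) = var (n ∸ M)
    unshift n (no _)  = σ n

    μ : Subst
    μ n = unshift n (M ≤? n)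

    μ-low : ∀ {n} → n < M → μ n ≡ σ n
    μ-low {n} n<M with M ≤? n
    ... | yes M≤n = ⊥-elim (<⇒≱ n<M M≤n)
    ... | no _    = refl

    μ-shift : ∀ n → μ (n + M) ≡ var n
    μ-shift n with M ≤? n + M
    ... | yes _      = cong var (m+n∸n≡m n M)
    ... | no M≰n+M = ⊥-elim (M≰n+M (m≤n+m M n))

    module _ (A : Algebra) (A⊨E : ModelOf E A) where
      open Algebra A
      open IsEquivalence isEquivalence using (reflexive) renaming (sym to ≈-sym; trans to ≈-trans)
      open Evaluation 𝓛 A

      Σ⊨Γ : ∀ v → (∀ ψ → ψ ∈ Σ → Designated A (eval A v ψ))
          → ∀ {γ} → γ ∈ Γ → Designated A (eval A v γ)
      Σ⊨Γ v vΣ {γ} γ∈Γ =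
        designated-resp A (eval-sub-cong σ γ σ≈id) (⊢⇒⊨ (All.lookup ⊢σΓ γ∈Γ) A A⊨E w λ _ ())
        where
          w : ℕ → Carrier
          w = eval A v ∘ κ

          σ≈id : ∀ x → Occurs x γ → eval A w (σ x) ≈ v x
          σ≈id x x∈γ with x ∈? C
          ... | yes x∈C = reflexive (trans (cong (eval A w) (ρ-var x x∈C)) (cong (eval A v) (κ-ρ x∈C)))
          ... | no x∉C  = ≈-trans (≈-sym (eval-sub κ (σ x) v))
                                  (≈-sym (graphΔ-designated⇒≈ A A⊨E v σ̃ vΣ (∈-q⁺ γ∈Γ x∈γ x∉C)))

      Σ⊨Θ⇒σΘ-designated : ∀ {Θ} → Θ allOver q → ⟦ Σ ⟧ ⊢*[ _⊢_ ] ⟦ Θ ⟧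
                         → ∀ v {θ'} → θ' ∈ Θ → Designated A (eval A v (sub σ θ'))
      Σ⊨Θ⇒σΘ-designated Θ-over Σ⊢Θ v {θ'} θ'∈Θ =
        designated-resp A (≈-sym (eval-sub-cong σ θ' σ≈μ)) (⊢⇒⊨ (Σ⊢Θ θ' θ'∈Θ) A A⊨E u uΣ)
        where
          u : ℕ → Carrier
          u = eval A v ∘ μ

          σ≈μ : ∀ x → Occurs x θ' → eval A v (σ x) ≈ u x
          σ≈μ x x∈θ' = reflexive (cong (eval A v) (sym (μ-low (∈-q⇒<M (All.lookup Θ-over θ'∈Θ x x∈θ')))))

          y≈σ̃y : ∀ {y} → y ∈ q → u y ≈ eval A u (σ̃ y)
          y≈σ̃y {y} y∈q = ≈-trans (reflexive (cong (eval A v) (μ-low (∈-q⇒<M y∈q))))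
            (≈-sym (eval-sub-cong κ (σ y) λ n n∈σy →
              reflexive (trans (cong (eval A u) (κ-shift y∈q n∈σy)) (cong (eval A v) (μ-shift n)))))

          uΣ : ∀ ψ → ψ ∈ Σ → Designated A (eval A u ψ)
          uΣ = ≈⇒graphΔ-designated A A⊨E u σ̃ y≈σ̃y

    Σ⊢Γ : ⟦ Σ ⟧ ⊢*[ _⊢_ ] ⟦ Γ ⟧
    Σ⊢Γ γ γ∈Γ = ⊨⇒⊢ λ A A⊨E v vΣ → Σ⊨Γ A A⊨E v vΣ γ∈Γ

    Σ⊢Θ⇒⊢σΘ : ∀ {Θ} → Θ allOver q → ⟦ Σ ⟧ ⊢*[ _⊢_ ] ⟦ Θ ⟧ → All (λ θ' → ∅ ⊢ sub σ θ') Θ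
    Σ⊢Θ⇒⊢σΘ Θ-over Σ⊢Θ = All.tabulate λ θ'∈Θ →
      ⊨⇒⊢ λ A A⊨E v _ → Σ⊨Θ⇒σΘ-designated A A⊨E Θ-over Σ⊢Θ v θ'∈Θ

    ⊢σφ : All (ClosedUnder ∘ Standard) interpolants → ∅ ⊢ sub σ φ
    ⊢σφ closed
      with find (θ-complete q r q-unique r-unique q⊥r Γ Γ-over p p-unique p⊥q p⊥r Σ Σ-over Σ⊢Γ)
    ... | Θ , Θ∈ , Σ⊢Θ = All.lookup closed Θ∈ σ id (standard-instance Θ φ σ)
      (Σ⊢Θ⇒⊢σΘ (proj₁ (interpolant-sound Θ∈)) Σ⊢Θ)

  interpolantsAdmissible⇔admissible : All (λ x → ¬ Occurs x φ) C
    → All (λ Θ → Admissible S (Standard Θ)) interpolants ⇔ Admissible S R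
  interpolantsAdmissible⇔admissible C∉φ = mk⇔
    (λ adms → closedUnder⇒admissible R λ σ ρ (ρ-var , ρ-injective , ρ-fresh) ⊢σΓ →
      InterpolantsToΠ2.⊢σφ σ ρ ρ-var ρ-injective ρ-fresh ⊢σΓ
        (All.map (admissible⇒closedUnder _) adms))
    (λ adm → All.tabulate λ Θ∈ → closedUnder⇒admissible _
      (closedUnderΠ2⇒closedUnderInterpolant C∉φ (admissible⇒closedUnder R adm) Θ∈))

theorem2p12 : (𝓛 : Signature) → let open Syntax 𝓛 in
    (_⊢_ : Cons) → IsLogic _⊢_ → StronglyAlgebraizable _⊢_
    → (S : HilbertSystem) → Presents S _⊢_
    → MaeharaInterpolation _⊢_
    → RightUniformDeductiveInterpolation _⊢_
    → EffectiveLeftFinitaryUDI _⊢_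
    → DecidableLogic _⊢_
    → StandardAdmissibilityDecidable S
    → Π2AdmissibilityDecidable S
theorem2p12 𝓛 _⊢_ L SA S S⊢ _ _ LU _ standard? C Γ φ _ C∉φ =
  Dec.map (interpolantsAdmissible⇔admissible C∉φ) (All.all? (λ Θ → standard? Θ φ) interpolants)
  where open Π2Reduction 𝓛 _⊢_ L SA S S⊢ LU C Γ φ
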